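{- Let $\mathcal{H}=(V,E)$ be a hypergraph with no repeated hyperedge, $V=\{v_1,\dots,v_n\}$, of range $k_{\max}\geq 2$, and let $\mathcal{A}_{\mathcal{H}}$ be its layered e-adjacency tensor (defined in the context). Let $\Delta=\max_{1\le i\le n}\deg(v_i)$ and $\Delta^\star=\max_{1\le i\le k_{\max}-1}\deg(y_i)$. Then every eigenvalue $\lambda$ of $\mathcal{A}_{\mathcal{H}}$ satisfies $|\lambda|\le \max(\Delta,\Delta^\star)$.
   Context: A hypergraph $\mathcal{H}=(V,E)$ on $V=\{v_1,\dots,v_n\}$ is a family $E$ of nonempty subsets (hyperedges) of $V$; it has no repeated hyperedge if its hyperedges are pairwise distinct. The range is $k_{\max}=\max\{|e|:e\in E\}$, and $\deg(v_i)$ is the number of hyperedges containing $v_i$. Introduce new pairwise distinct vertices $y_1,\dots,y_{k_{\max}-1}\notin V$. The layered uniform hypergraph of $\mathcal{H}$ is the $k_{\max}$-uniform hypergraph on $V\cup\{y_1,\dots,y_{k_{\max}-1}\}$ with hyperedges $e\cup\{y_{|e|},\dots,y_{k_{\max}-1}\}$ for $e\in E$; $\deg(y_i)$ is the number of these hyperedges containing $y_i$. The layered e-adjacency tensor $\mathcal{A}_{\mathcal{H}}=(a_{i_1\dots i_{k_{\max}}})$ is the symmetric hypermatrix of order $k_{\max}$ and dimension $N=n+k_{\max}-1$ (index $i\le n$ for $v_i$, index $n+l$ for $y_l$) such that: for each $e=\{v_{i_1},\dots,v_{i_j}\}\in E$ with $i_1<\dots<i_j$, putting $i_l=n+l-1$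 for $l\in\{j+1,\dots,k_{\max}\}$, every entry whose index tuple is a permutation of $(i_1,\dots,i_{k_{\max}})$ equals $\frac{1}{(k_{\max}-1)!}$; all other entries are $0$. Eigenvalues (in the sense of Qi): for a hypermatrix $\mathcal{A}=(a_{i_1\dots i_m})$ of order $m$ and dimension $N$, $\lambda\in\mathbb{C}$ is an eigenvalue if there exists a nonzero $x\in\mathbb{C}^N$ with $\sum_{i_2,\dots,i_m=1}^{N} a_{i i_2\dots i_m}x_{i_2}\cdots x_{i_m}=\lambda x_i^{m-1}$ for all $i\in\{1,\dots,N\}$. -}

module Defs where

open import Algebra.Bundles.Raw using (RawSemiring)
import Algebra.Definitions.RawSemiring as RawSemiringDefinitions
open import Data.Bool.Base using (if_then_else_)
open import Data.Empty using (⊥-elim)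
open import Data.Fin.Base using (Fin; toℕ; _↑ˡ_; _↑ʳ_)
import Data.Fin.Properties as Fin
open import Data.Fin.Subset using (Subset; Nonempty; _∈_) renaming (∣_∣ to card)
open import Data.Fin.Subset.Properties using (_∈?_)
open import Data.Integer.Base as ℤ using (+_; -[1+_])
import Data.Integer.Properties as ℤ
import Data.Integer.Solver as ℤSolver
open import Data.List.Base as List using (List; []; _∷_; _++_; length; filter; map; allFin)
open import Data.List.Extrema.Nat using (max)
open import Data.List.Membership.Propositional.Properties using (∈-∃++)
import Data.List.Membership.DecPropositional as DecMembership
open import Data.List.Relation.Unary.All as All using (All)
import Data.List.Relation.Unary.All.Properties as All
open import Data.List.Relation.Unary.Any using (any?; here)
open import Data.List.Relation.Unary.Unique.Propositional using (Unique)
open import Data.List.Relation.Binary.Permutation.Propositional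
  using (_↭_; ↭-refl; ↭-sym; ↭-trans; prep)
open import Data.List.Relation.Binary.Permutation.Propositional.Properties
  using (¬x∷xs↭[]; drop-∷; shift; ∈-resp-↭)
open import Data.Nat.Base as ℕ using (ℕ; zero; suc; _∸_; _!)
import Data.Nat.Properties as ℕ
open import Data.Product.Base using (Σ-syntax; ∃-syntax; _×_; _,_; proj₁; proj₂)
open import Data.Rational.Base as ℚ
  using (ℚ; mkℚ; 0ℚ; 1ℚ; ½; _+_; _*_; _-_; -_; _≤_; _<_; ∣_∣; _/_; _⊔_; 1/_; *<*; ↥_)
import Data.Rational.Properties as ℚ
import Data.Rational.Unnormalised.Base as ℚᵘ
import Data.Rational.Unnormalised.Properties as ℚᵘ
open import Data.Rational.Solver using (module +-*-Solver)
open import Data.Sum.Base using (inj₁; inj₂)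
open import Data.Vec.Base as Vec using (Vec; []; _∷_)
open import Data.Vec.Functional using (Vector)
open import Level using (0ℓ)
open import Relation.Binary.Definitions using (DecidableEquality)
open import Relation.Binary.PropositionalEquality
  using (_≡_; refl; sym; trans; cong; cong₂; subst; subst₂)
open import Relation.Unary using (Decidable)
open import Relation.Nullary using (¬_; Dec; yes; no; does)

private

  pos*pos : ∀ {p q} → 0ℚ < p → 0ℚ < q → 0ℚ < p * q
  pos*pos {p} {q} 0<p 0<q = subst (_< p * q) (ℚ.*-zeroʳ p)
    (ℚ.*-monoʳ-<-pos p {{ℚ.positive 0<p}} 0<q)

  half-pos : ∀ {ε} → 0ℚ < ε → 0ℚ < ½ * ε
  half-pos = pos*pos (ℚ.positive⁻¹ ½)

  half+half : ∀ ε → ½ * ε + ½ * ε ≡ ε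
  half+half ε = trans (sym (ℚ.*-distribʳ-+ ε ½ ½)) (ℚ.*-identityˡ ε)

  nonNeg : ∀ {p} → 0ℚ ≤ p → ℚ.NonNegative p
  nonNeg = ℚ.nonNegative

  *-mono-≤-nonNeg : ∀ {p q r s} → 0ℚ ≤ q → 0ℚ ≤ r → p ≤ q → r ≤ s → p * r ≤ q * s
  *-mono-≤-nonNeg {p} {q} {r} {s} 0≤q 0≤r p≤q r≤s = ℚ.≤-trans
    (ℚ.*-monoʳ-≤-nonNeg r {{nonNeg 0≤r}} p≤q)
    (ℚ.*-monoˡ-≤-nonNeg q {{nonNeg 0≤q}} r≤s)

  ≤-+ʳ : ∀ {p q} → 0ℚ ≤ q → p ≤ p + q
  ≤-+ʳ {p} {q} 0≤q = subst (_≤ p + q) (ℚ.+-identityʳ p) (ℚ.+-monoʳ-≤ p 0≤q)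

  p≤∣p∣ : ∀ p → p ≤ ∣ p ∣
  p≤∣p∣ p with ℚ.≤-total 0ℚ p
  ... | inj₁ 0≤p = ℚ.≤-reflexive (sym (ℚ.0≤p⇒∣p∣≡p 0≤p))
  ... | inj₂ p≤0 = ℚ.≤-trans p≤0 (ℚ.0≤∣p∣ p)

  ∣p-q∣≡∣q-p∣ : ∀ p q → ∣ p - q ∣ ≡ ∣ q - p ∣
  ∣p-q∣≡∣q-p∣ p q = trans (cong ∣_∣ (solve 2 (λ a b → a :- b := :- (b :- a)) refl p q))
    (ℚ.∣-p∣≡∣p∣ (q - p))
    where open +-*-Solver

  ∣-∣<⇒< : ∀ {p q ε} → ∣ p - q ∣ < ε → p < q + ε
  ∣-∣<⇒< {p} {q} {ε} h = subst (_< q + ε)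
    (solve 2 (λ a b → b :+ (a :- b) := a) refl p q)
    (ℚ.+-monoʳ-< q (ℚ.≤-<-trans (p≤∣p∣ (p - q)) h))
    where open +-*-Solver

  <⇒∣-∣< : ∀ {p q ε} → p < q + ε → q < p + ε → ∣ p - q ∣ < ε
  <⇒∣-∣< {p} {q} {ε} h₁ h₂ with ℚ.∣p∣≡p∨∣p∣≡-p (p - q)
  ... | inj₁ eq = subst₂ _<_ (sym eq)
    (solve 2 (λ b e → (b :+ e) :- b := e) refl q ε) (ℚ.+-monoˡ-< (- q) h₁)
    where open +-*-Solver
  ... | inj₂ eq = subst₂ _<_ (trans (solve 2 (λ a b → b :- a := :- (a :- b)) refl p q) (sym eq))
    (solve 2 (λ a e → (a :+ e) :- a := e) refl p ε) (ℚ.+-monoˡ-< (- p) h₂)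
    where open +-*-Solver

  /-mono-≤ : ∀ a b c d → a ℕ.* suc d ℕ.≤ c ℕ.* suc b → + a / suc b ≤ + c / suc d
  /-mono-≤ a b c d h = ℚ.toℚᵘ-cancel-≤
    (ℚᵘ.≤-respˡ-≃ (ℚᵘ.≃-sym (ℚ.toℚᵘ-fromℚᵘ (ℚᵘ.mkℚᵘ (+ a) b)))
    (ℚᵘ.≤-respʳ-≃ (ℚᵘ.≃-sym (ℚ.toℚᵘ-fromℚᵘ (ℚᵘ.mkℚᵘ (+ c) d)))
    (ℚᵘ.*≤* (subst₂ ℤ._≤_ (ℤ.pos-* a (suc d)) (ℤ.pos-* c (suc b)) (ℤ.+≤+ h)))))

  0≤/ : ∀ a b → 0ℚ ≤ + a / suc b
  0≤/ a b = ℚ.≤-trans (ℚ.≤-reflexive (sym (ℚ.0/n≡0 (suc b)))) (/-mono-≤ 0 b a b ℕ.z≤n)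

  +-/ : ∀ k n → + suc k / suc n ≡ + k / suc n + + 1 / suc n
  +-/ k n = ℚ.toℚᵘ-injective (ℚᵘ.≃-trans (ℚ.toℚᵘ-fromℚᵘ (ℚᵘ.mkℚᵘ (+ suc k) n))
    (ℚᵘ.≃-sym (ℚᵘ.≃-trans (ℚ.toℚᵘ-homo-+ (+ k / suc n) (+ 1 / suc n))
    (ℚᵘ.≃-trans (ℚᵘ.+-cong (ℚ.toℚᵘ-fromℚᵘ (ℚᵘ.mkℚᵘ (+ k) n)) (ℚ.toℚᵘ-fromℚᵘ (ℚᵘ.mkℚᵘ (+ 1) n)))
    (ℚᵘ.*≡* lemma)))))
    where
    open ℤSolver.+-*-Solver
    lemma : (+ k ℤ.* + suc n ℤ.+ + 1 ℤ.* + suc n) ℤ.* + suc n ≡ + suc k ℤ.* (+ suc n ℤ.* + suc n)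
    lemma = solve 2 (λ K N → (K :* N :+ con (+ 1) :* N) :* N := (con (+ 1) :+ K) :* (N :* N)) refl (+ k) (+ suc n)

  archimedean : ∀ {ε} → 0ℚ < ε → ∃[ N ] (∀ n → N ℕ.≤ n → + 1 / suc n ≤ ε)
  archimedean {mkℚ (+ zero) d _} (*<* (ℤ.+<+ ()))
  archimedean {mkℚ -[1+ _ ] d _} (*<* ())
  archimedean {ε@(mkℚ (+ suc p) d _)} _ = d , λ n d≤n →
    subst (+ 1 / suc n ≤_) (ℚ.↥p/↧p≡p ε)
      (/-mono-≤ 1 n (suc p) d (ℕ.*-mono-≤ {1} {suc p} {suc d} {suc n} (ℕ.s≤s ℕ.z≤n) (ℕ.s≤s d≤n)))

-- Real numbers are Cauchy sequences of rationals, considered up to _≈ᴿ_.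

IsCauchy : (ℕ → ℚ) → Set
IsCauchy x = ∀ ε → 0ℚ < ε → ∃[ N ] (∀ m n → N ℕ.≤ m → N ℕ.≤ n → ∣ x m - x n ∣ < ε)

record ℝ : Set where
  constructor mkℝ
  field
    seq    : ℕ → ℚ
    cauchy : IsCauchy seq

open ℝ public

infix 4 _≈ᴿ_ _≤ᴿ_

_≈ᴿ_ : ℝ → ℝ → Set
x ≈ᴿ y = ∀ ε → 0ℚ < ε → ∃[ N ] (∀ n → N ℕ.≤ n → ∣ seq x n - seq y n ∣ < ε)

_≤ᴿ_ : ℝ → ℝ → Set
x ≤ᴿ y = ∀ ε → 0ℚ < ε → ∃[ N ] (∀ n → N ℕ.≤ n → seq x n ≤ seq y n + ε)

fromℚ : ℚ → ℝ
fromℚ q = mkℝ (λ _ → q) λ ε 0<ε → 0 , λ _ _ _ _ →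
  subst (_< ε) (sym (cong ∣_∣ (ℚ.+-inverseʳ q))) 0<ε

fromℕ : ℕ → ℝ
fromℕ n = fromℚ (+ n / 1)

infixl 6 _+ᴿ_
infixl 7 _*ᴿ_
infix  8 -ᴿ_

_+ᴿ_ : ℝ → ℝ → ℝ
x +ᴿ y = mkℝ (λ n → seq x n + seq y n) λ ε 0<ε →
  let (M , hx) = cauchy x (½ * ε) (half-pos 0<ε)
      (N , hy) = cauchy y (½ * ε) (half-pos 0<ε)
  in M ℕ.⊔ N , λ m n m≥ n≥ →
  subst₂ _<_ refl (half+half ε)
    (ℚ.≤-<-trans
      (subst (λ t → ∣ t ∣ ≤ ∣ seq x m - seq x n ∣ + ∣ seq y m - seq y n ∣)
        (solve 4 (λ a b c d → (a :- b) :+ (c :- d) := (a :+ c) :- (b :+ d)) refl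
          (seq x m) (seq x n) (seq y m) (seq y n))
        (ℚ.∣p+q∣≤∣p∣+∣q∣ (seq x m - seq x n) (seq y m - seq y n)))
      (ℚ.+-mono-< (hx m n (ℕ.m⊔n≤o⇒m≤o M N m≥) (ℕ.m⊔n≤o⇒m≤o M N n≥))
                  (hy m n (ℕ.m⊔n≤o⇒n≤o M N m≥) (ℕ.m⊔n≤o⇒n≤o M N n≥))))
  where open +-*-Solver

-ᴿ_ : ℝ → ℝ
-ᴿ x = mkℝ (λ n → - seq x n) λ ε 0<ε →
  let (N , h) = cauchy x ε 0<ε in N , λ m n m≥ n≥ →
  subst (_< ε)
    (trans (∣p-q∣≡∣q-p∣ (seq x m) (seq x n))
      (cong ∣_∣ (solve 2 (λ a b → b :- a := (:- a) :- (:- b)) refl (seq x m) (seq x n))))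
    (h m n m≥ n≥)
  where open +-*-Solver

private

  eventually-bounded : ∀ x → ∃[ B ] (0ℚ < B × ∃[ N ] (∀ n → N ℕ.≤ n → ∣ seq x n ∣ ≤ B))
  eventually-bounded x =
    let (N , h) = cauchy x 1ℚ (ℚ.positive⁻¹ 1ℚ)
        a = seq x N
    in 1ℚ + ∣ a ∣ , ℚ.<-≤-trans (ℚ.positive⁻¹ 1ℚ) (≤-+ʳ (ℚ.0≤∣p∣ a)) , N , λ n n≥ →
    ℚ.≤-trans
      (subst (λ t → ∣ t ∣ ≤ ∣ seq x n - a ∣ + ∣ a ∣)
        (solve 2 (λ b c → (b :- c) :+ c := b) refl (seq x n) a)
        (ℚ.∣p+q∣≤∣p∣+∣q∣ (seq x n - a) a))
      (ℚ.+-monoˡ-≤ ∣ a ∣ (ℚ.<⇒≤ (h n N n≥ ℕ.≤-refl)))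
    where open +-*-Solver

private

  shrink : ∀ {B ε} → 0ℚ < B → 0ℚ < ε → ∃[ δ ] (0ℚ < δ × B * δ ≡ ε)
  shrink {B} {ε} 0<B 0<ε = inv * ε ,
    pos*pos (ℚ.positive⁻¹ inv {{ℚ.1/pos⇒pos B {{ℚ.positive 0<B}}}}) 0<ε ,
    trans (sym (ℚ.*-assoc B inv ε))
      (trans (cong (_* ε) (ℚ.*-inverseʳ B {{ℚ.pos⇒nonZero B {{ℚ.positive 0<B}}}}))
        (ℚ.*-identityˡ ε))
    where
    inv : ℚ
    inv = (1/ B) {{ℚ.pos⇒nonZero B {{ℚ.positive 0<B}}}}

  product-close : ∀ a b c d {A D δ γ ε} → 0ℚ < A → 0ℚ < D →
    ∣ a ∣ ≤ A → ∣ d ∣ ≤ D → ∣ a - b ∣ < δ → ∣ c - d ∣ < γ →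
    A * γ ≡ ½ * ε → D * δ ≡ ½ * ε → ∣ a * c - b * d ∣ < ε
  product-close a b c d {A} {D} {δ} {γ} {ε} 0<A 0<D a≤A d≤D a-b c-d eqA eqD =
    ℚ.≤-<-trans
      (subst (λ t → ∣ t ∣ ≤ ∣ a * (c - d) ∣ + ∣ d * (a - b) ∣)
        (solve 4 (λ a b c d → a :* (c :- d) :+ d :* (a :- b) := a :* c :- b :* d) refl a b c d)
        (ℚ.∣p+q∣≤∣p∣+∣q∣ (a * (c - d)) (d * (a - b))))
      (subst (∣ a * (c - d) ∣ + ∣ d * (a - b) ∣ <_)
        (trans (cong₂ _+_ eqA eqD) (half+half ε))
        (ℚ.+-mono-≤-< first second))
    where
    open +-*-Solver
    first : ∣ a * (c - d) ∣ ≤ A * γ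
    first = subst (_≤ A * γ) (sym (ℚ.∣p*q∣≡∣p∣*∣q∣ a (c - d)))
      (*-mono-≤-nonNeg (ℚ.<⇒≤ 0<A) (ℚ.0≤∣p∣ (c - d)) a≤A (ℚ.<⇒≤ c-d))
    second : ∣ d * (a - b) ∣ < D * δ
    second = subst (_< D * δ) (sym (ℚ.∣p*q∣≡∣p∣*∣q∣ d (a - b)))
      (ℚ.≤-<-trans
        (ℚ.*-monoʳ-≤-nonNeg ∣ a - b ∣ {{ℚ.∣-∣-nonNeg (a - b)}} d≤D)
        (ℚ.*-monoʳ-<-pos D {{ℚ.positive 0<D}} a-b))

  *-cauchy : ∀ x y → IsCauchy (λ n → seq x n * seq y n)
  *-cauchy x y ε 0<ε =
    let (A , 0<A , K , hA) = eventually-bounded x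
        (D , 0<D , L , hD) = eventually-bounded y
        (δ , 0<δ , eqD)    = shrink 0<D (half-pos 0<ε)
        (γ , 0<γ , eqA)    = shrink 0<A (half-pos 0<ε)
        (M , hx)           = cauchy x δ 0<δ
        (N , hy)           = cauchy y γ 0<γ
    in (K ℕ.⊔ L) ℕ.⊔ (M ℕ.⊔ N) , λ m n m≥ n≥ →
    let m≥KL = ℕ.m⊔n≤o⇒m≤o (K ℕ.⊔ L) (M ℕ.⊔ N) m≥
        n≥KL = ℕ.m⊔n≤o⇒m≤o (K ℕ.⊔ L) (M ℕ.⊔ N) n≥
        m≥MN = ℕ.m⊔n≤o⇒n≤o (K ℕ.⊔ L) (M ℕ.⊔ N) m≥
        n≥MN = ℕ.m⊔n≤o⇒n≤o (K ℕ.⊔ L) (M ℕ.⊔ N) n≥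
    in product-close (seq x m) (seq x n) (seq y m) (seq y n) 0<A 0<D
      (hA m (ℕ.m⊔n≤o⇒m≤o K L m≥KL)) (hD n (ℕ.m⊔n≤o⇒n≤o K L n≥KL))
      (hx m n (ℕ.m⊔n≤o⇒m≤o M N m≥MN) (ℕ.m⊔n≤o⇒m≤o M N n≥MN))
      (hy m n (ℕ.m⊔n≤o⇒n≤o M N m≥MN) (ℕ.m⊔n≤o⇒n≤o M N n≥MN))
      eqA eqD

_*ᴿ_ : ℝ → ℝ → ℝ
x *ᴿ y = mkℝ (λ n → seq x n * seq y n) (*-cauchy x y)

-- The largest positive k ≤ K satisfying P, or 0 if there is none.
largest : {P : ℕ → Set} → Decidable P → ℕ → ℕ
largest P? zero    = 0
largest P? (suc K) = if does (P? (suc K)) then suc K else largest P? K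

largest-sat : ∀ {P : ℕ → Set} (P? : Decidable P) K → P 0 → P (largest P? K)
largest-sat P? zero    p₀ = p₀
largest-sat P? (suc K) p₀ with P? (suc K)
... | yes p = p
... | no  _ = largest-sat P? K p₀

largest-max : ∀ {P : ℕ → Set} (P? : Decidable P) K → ¬ P (suc K) → ¬ P (suc (largest P? K))
largest-max P? zero    ¬p = ¬p
largest-max P? (suc K) ¬p with P? (suc K)
... | yes _  = ¬p
... | no ¬p′ = largest-max P? K ¬p′

SquareBelow : ℚ → ℕ → ℕ → Set
SquareBelow a n k = (+ k / suc n) * (+ k / suc n) ≤ a

squareBelow? : ∀ a n → Decidable (SquareBelow a n)
squareBelow? a n k = (+ k / suc n) * (+ k / suc n) ℚ.≤? a

rootBound : ℚ → ℕ → ℕ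
rootBound a n = suc ℤ.∣ ↥ a ∣ ℕ.* suc n

-- For a ≥ 0, a multiple s of 1 / suc n with s² ≤ a < (s + 1 / suc n)²; the
-- search bound is no restriction, as a < (suc ∣ ↥ a ∣)².
approxRoot : ℚ → ℕ → ℚ
approxRoot a n = + largest (squareBelow? a n) (rootBound a n) / suc n

approxRoot-nonNeg : ∀ a n → 0ℚ ≤ approxRoot a n
approxRoot-nonNeg a n = 0≤/ (largest (squareBelow? a n) (rootBound a n)) n

approxRoot-lower : ∀ a n → 0ℚ ≤ a → approxRoot a n * approxRoot a n ≤ a
approxRoot-lower a n 0≤a = largest-sat (squareBelow? a n) (rootBound a n)
  (subst (_≤ a) (sym (trans (cong (λ t → t * t) (ℚ.0/n≡0 (suc n))) (ℚ.*-zeroˡ 0ℚ))) 0≤a)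

approxRoot-upper : ∀ a n →
  a < (approxRoot a n + + 1 / suc n) * (approxRoot a n + + 1 / suc n)
approxRoot-upper a n = subst (λ t → a < t * t)
  (+-/ (largest (squareBelow? a n) bound) n)
  (ℚ.≰⇒> (largest-max (squareBelow? a n) bound (λ h → ℚ.<-irrefl refl (ℚ.<-≤-trans start h))))
  where
  bound : ℕ
  bound = rootBound a n
  c : ℚ
  c = + suc bound / suc n
  1≤c : 1ℚ ≤ c
  1≤c = /-mono-≤ 1 0 (suc bound) n (begin
    1 ℕ.* suc n                      ≤⟨ ℕ.*-monoˡ-≤ (suc n) {1} {suc ℤ.∣ ↥ a ∣} (ℕ.s≤s ℕ.z≤n) ⟩
    bound                            ≤⟨ ℕ.n≤1+n bound ⟩
    suc bound                        ≡⟨ ℕ.*-identityʳ (suc bound) ⟨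
    suc bound ℕ.* 1                  ∎)
    where open ℕ.≤-Reasoning
  a≤∣↥a∣ : ∀ b → b ≤ + ℤ.∣ ↥ b ∣ / 1
  a≤∣↥a∣ b@(mkℚ (+ p) d _) = subst (_≤ + p / 1) (ℚ.↥p/↧p≡p b)
    (/-mono-≤ p d p 0 (ℕ.*-monoʳ-≤ p (ℕ.s≤s ℕ.z≤n)))
  a≤∣↥a∣ b@(mkℚ -[1+ p ] d _) = ℚ.≤-trans (ℚ.<⇒≤ (ℚ.negative⁻¹ b)) (0≤/ (suc p) 0)
  a<c : a < c
  a<c = ℚ.≤-<-trans (a≤∣↥a∣ a) (ℚ.<-≤-trans
    (subst (+ ℤ.∣ ↥ a ∣ / 1 <_) (sym (+-/ ℤ.∣ ↥ a ∣ 0))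
      (subst (_< + ℤ.∣ ↥ a ∣ / 1 + 1ℚ) (ℚ.+-identityʳ (+ ℤ.∣ ↥ a ∣ / 1))
        (ℚ.+-monoʳ-< (+ ℤ.∣ ↥ a ∣ / 1) (ℚ.positive⁻¹ 1ℚ))))
    (/-mono-≤ (suc ℤ.∣ ↥ a ∣) 0 (suc bound) n
      (ℕ.≤-trans (ℕ.n≤1+n bound) (ℕ.≤-reflexive (sym (ℕ.*-identityʳ (suc bound)))))))
  start : a < c * c
  start = ℚ.<-≤-trans a<c (subst (_≤ c * c) (ℚ.*-identityʳ c)
    (ℚ.*-monoˡ-≤-nonNeg c {{nonNeg (0≤/ (suc bound) n)}} 1≤c))

-- The square root of max x 0.
√ : ℝ → ℝ
√ x = mkℝ s cauchy√
  where
  open +-*-Solver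
  s : ℕ → ℚ
  s n = approxRoot (seq x n ⊔ 0ℚ) n
  cauchy√ : IsCauchy s
  cauchy√ ε 0<ε = M ℕ.⊔ N , λ m n m≥ n≥ → <⇒∣-∣< (close m n m≥ n≥) (close n m n≥ m≥)
    where
    δ : ℚ
    δ = ½ * ε
    0<δ : 0ℚ < δ
    0<δ = half-pos 0<ε
    M N : ℕ
    M = proj₁ (archimedean 0<δ)
    N = proj₁ (cauchy x (δ * δ) (pos*pos 0<δ 0<δ))
    close : ∀ m n → M ℕ.⊔ N ℕ.≤ m → M ℕ.⊔ N ℕ.≤ n → s m < s n + ε
    close m n m≥ n≥ = ℚ.≰⇒> λ sn+ε≤sm → ℚ.<-irrefl refl (begin-strict
      s m * s m                       ≤⟨ approxRoot-lower (xm ⊔ 0ℚ) m (ℚ.p≤q⊔p xm 0ℚ) ⟩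
      xm ⊔ 0ℚ                         ≤⟨ ℚ.⊔-lub xm≤ 0≤xn+δ² ⟩
      (xn ⊔ 0ℚ) + δ * δ               <⟨ ℚ.+-monoˡ-< (δ * δ) (approxRoot-upper (xn ⊔ 0ℚ) n) ⟩
      t * t + δ * δ                   ≤⟨ ≤-+ʳ (0≤* (0≤* 0≤t (ℚ.<⇒≤ 0<δ)) (ℚ.nonNegative⁻¹ (1ℚ + 1ℚ))) ⟩
      t * t + δ * δ + t * δ * (1ℚ + 1ℚ)
        ≡⟨ solve 2 (λ t d → t :* t :+ d :* d :+ t :* d :* (con 1ℚ :+ con 1ℚ)
                            := (t :+ d) :* (t :+ d)) refl t δ ⟩
      (t + δ) * (t + δ)               ≤⟨ *-mono-≤-nonNeg 0≤sm 0≤t+δ (t+δ≤sm sn+ε≤sm) (t+δ≤sm sn+ε≤sm) ⟩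
      s m * s m                       ∎)
      where
      open ℚ.≤-Reasoning
      xm xn t : ℚ
      xm = seq x m
      xn = seq x n
      t = s n + + 1 / suc n
      0≤* : ∀ {p q} → 0ℚ ≤ p → 0ℚ ≤ q → 0ℚ ≤ p * q
      0≤* {p} {q} hp hq = subst (_≤ p * q) (ℚ.*-zeroˡ 0ℚ) (*-mono-≤-nonNeg hp ℚ.≤-refl hp hq)
      0≤+ : ∀ {p q} → 0ℚ ≤ p → 0ℚ ≤ q → 0ℚ ≤ p + q
      0≤+ hp hq = ℚ.≤-trans hp (≤-+ʳ hq)
      0≤sm : 0ℚ ≤ s m
      0≤sm = approxRoot-nonNeg (xm ⊔ 0ℚ) m
      0≤t : 0ℚ ≤ t
      0≤t = 0≤+ (approxRoot-nonNeg (xn ⊔ 0ℚ) n) (0≤/ 1 n)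
      0≤t+δ : 0ℚ ≤ t + δ
      0≤t+δ = 0≤+ 0≤t (ℚ.<⇒≤ 0<δ)
      δ² : 0ℚ ≤ δ * δ
      δ² = ℚ.<⇒≤ (pos*pos 0<δ 0<δ)
      xm≤ : xm ≤ (xn ⊔ 0ℚ) + δ * δ
      xm≤ = ℚ.≤-trans
        (ℚ.<⇒≤ (∣-∣<⇒< (proj₂ (cauchy x (δ * δ) (pos*pos 0<δ 0<δ)) m n
          (ℕ.m⊔n≤o⇒n≤o M N m≥) (ℕ.m⊔n≤o⇒n≤o M N n≥))))
        (ℚ.+-monoˡ-≤ (δ * δ) (ℚ.p≤p⊔q xn 0ℚ))
      0≤xn+δ² : 0ℚ ≤ (xn ⊔ 0ℚ) + δ * δ
      0≤xn+δ² = 0≤+ (ℚ.p≤q⊔p xn 0ℚ) δ²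
      t+δ≤sn+ε : t + δ ≤ s n + ε
      t+δ≤sn+ε = subst₂ _≤_ (sym (ℚ.+-assoc (s n) (+ 1 / suc n) δ)) refl
        (ℚ.+-monoʳ-≤ (s n) (subst (+ 1 / suc n + δ ≤_) (half+half ε)
          (ℚ.+-monoˡ-≤ δ (proj₂ (archimedean 0<δ) n (ℕ.m⊔n≤o⇒m≤o M N n≥)))))
      t+δ≤sm : s n + ε ≤ s m → t + δ ≤ s m
      t+δ≤sm = ℚ.≤-trans t+δ≤sn+ε

record ℂ : Set where
  constructor _+i_
  field
    re im : ℝ

open ℂ public

infix 4 _≈ᶜ_
infix 5 _+i_
infixl 6 _+ᶜ_
infixl 7 _*ᶜ_

_≈ᶜ_ : ℂ → ℂ → Set
z ≈ᶜ w = re z ≈ᴿ re w × im z ≈ᴿ im w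

_+ᶜ_ _*ᶜ_ : ℂ → ℂ → ℂ
z +ᶜ w = (re z +ᴿ re w) +i (im z +ᴿ im w)
z *ᶜ w = (re z *ᴿ re w +ᴿ -ᴿ (im z *ᴿ im w)) +i (re z *ᴿ im w +ᴿ im z *ᴿ re w)

ℚ→ℂ : ℚ → ℂ
ℚ→ℂ q = fromℚ q +i fromℚ 0ℚ

0ᶜ 1ᶜ : ℂ
0ᶜ = ℚ→ℂ 0ℚ
1ᶜ = ℚ→ℂ 1ℚ

∣_∣ᶜ : ℂ → ℝ
∣ z ∣ᶜ = √ (re z *ᴿ re z +ᴿ im z *ᴿ im z)

ℂ-rawSemiring : RawSemiring 0ℓ 0ℓ
ℂ-rawSemiring = record
  { Carrier = ℂ ; _≈_ = _≈ᶜ_ ; _+_ = _+ᶜ_ ; _*_ = _*ᶜ_ ; 0# = 0ᶜ ; 1# = 1ᶜ }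

open RawSemiringDefinitions ℂ-rawSemiring public
  using (sum; product) renaming (_^_ to _^ᶜ_)

Hypermatrix : ℕ → ℕ → Set
Hypermatrix m N = Vec (Fin N) m → ℂ

sumTuples : ∀ {N} m → (Vec (Fin N) m → ℂ) → ℂ
sumTuples zero    f = f []
sumTuples (suc m) f = sum (λ i → sumTuples m (λ t → f (i ∷ t)))

-- For an order m+1. That x is nonzero is the negation of x ≈ 0, the weakest
-- constructive reading of this hypothesis.
IsEigenvalue : ∀ {m N} → Hypermatrix (suc m) N → ℂ → Set
IsEigenvalue {m} {N} A μ = Σ[ x ∈ Vector ℂ N ]
  ¬ (∀ i → x i ≈ᶜ 0ᶜ) ×
  (∀ i → sumTuples m (λ t → A (i ∷ t) *ᶜ product (λ j → x (Vec.lookup t j))) ≈ᶜ μ *ᶜ x i ^ᶜ m)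

record Hypergraph (n : ℕ) : Set where
  field
    hyperedges : List (Subset n)
    nonempty   : All Nonempty hyperedges

open Hypergraph public

NoRepeatedHyperedge : ∀ {n} → Hypergraph n → Set
NoRepeatedHyperedge H = Unique (hyperedges H)

range : ∀ {n} → Hypergraph n → ℕ
range H = max 0 (map card (hyperedges H))

degree : ∀ {n} → Hypergraph n → Fin n → ℕ
degree H v = length (filter (v ∈?_) (hyperedges H))

-- The l-th element (counting from 0) of Fin (range H ∸ 1) stands for the
-- added vertex y_{l+1}; vertex v_i of H becomes i ↑ˡ _ and y_{l+1} is n ↑ʳ l.
addedVertices : ∀ {n} → Hypergraph n → ℕ
addedVertices H = range H ∸ 1

-- e ∪ { y_∣e∣ , … , y_{k-1} }
layeredEdge : ∀ {n} (k-1 : ℕ) → Subset n → Subset (n ℕ.+ k-1)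
layeredEdge k-1 e = e Vec.++ Vec.tabulate (λ l → does (card e ℕ.≤? suc (toℕ l)))

private
  layeredEdge-nonempty : ∀ {n} k-1 (e : Subset n) → Nonempty e → Nonempty (layeredEdge k-1 e)
  layeredEdge-nonempty k-1 e (v , v∈e) = v ↑ˡ k-1 , ∈-++ˡ v∈e
    where
    ∈-++ˡ : ∀ {n k} {p : Subset n} {q : Subset k} {v} → v ∈ p → v ↑ˡ k ∈ p Vec.++ q
    ∈-++ˡ Vec.here        = Vec.here
    ∈-++ˡ (Vec.there v∈p) = Vec.there (∈-++ˡ v∈p)

layeredUniform : ∀ {n} (H : Hypergraph n) → Hypergraph (n ℕ.+ addedVertices H)
layeredUniform H = record
  { hyperedges = map (layeredEdge (addedVertices H)) (hyperedges H)
  ; nonempty   = All.map⁺ (All.map (λ {e} → layeredEdge-nonempty (addedVertices H) e) (nonempty H))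
  }

Δ : ∀ {n} → Hypergraph n → ℕ
Δ {n} H = max 0 (map (degree H) (allFin n))

Δ⋆ : ∀ {n} → Hypergraph n → ℕ
Δ⋆ {n} H = max 0 (map (λ l → degree (layeredUniform H) (n ↑ʳ l)) (allFin (addedVertices H)))

-- The index sequence (i₁ , … , i_k): the elements of e in increasing order,
-- followed by the indices n+j , … , n+k-1 of y_j , … , y_{k-1}, where j = ∣e∣.
indexSequence : ∀ {n} (k-1 : ℕ) → Subset n → List (Fin (n ℕ.+ k-1))
indexSequence {n} k-1 e =
  map (_↑ˡ k-1) (filter (_∈? e) (allFin n)) ++
  map (n ↑ʳ_) (filter (λ l → card e ℕ.≤? suc (toℕ l)) (allFin k-1))

private
  ↭-dec : ∀ {A : Set} → DecidableEquality A → (xs ys : List A) → Dec (xs ↭ ys)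
  ↭-dec _≟_ [] []       = yes ↭-refl
  ↭-dec _≟_ [] (y ∷ ys) = no λ p → ¬x∷xs↭[] (↭-sym p)
  ↭-dec _≟_ (x ∷ xs) ys with DecMembership._∈?_ _≟_ x ys
  ... | no x∉ys = no λ p → x∉ys (∈-resp-↭ p (here refl))
  ... | yes x∈ys with ∈-∃++ x∈ys
  ...   | as , bs , refl with ↭-dec _≟_ xs (as ++ bs)
  ...     | yes p = yes (↭-trans (prep x p) (↭-sym (shift x as bs)))
  ...     | no ¬p = no λ p → ¬p (drop-∷ (↭-trans p (shift x as bs)))

infix 4 _↭?_

_↭?_ : ∀ {N} (xs ys : List (Fin N)) → Dec (xs ↭ ys)
_↭?_ = ↭-dec Fin._≟_

-- The order suc (range H ∸ 1) is k_max = range H, which is positive as soon as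
-- H has a hyperedge, and the dimension is n + k_max - 1.
layeredTensor : ∀ {n} (H : Hypergraph n) →
                Hypermatrix (suc (range H ∸ 1)) (n ℕ.+ addedVertices H)
layeredTensor H t =
  if does (any? (λ e → Vec.toList t ↭? indexSequence (addedVertices H) e) (hyperedges H))
  then ℚ→ℂ ((+ 1 / (range H ∸ 1) !) {{(range H ∸ 1) ℕ.!≢0}})
  else 0ᶜ

{-# OPTIONS --safe #-}

-- At an index n let M be the largest modulus of an entry of x. The absolute row sums of the
-- tensor are at most D = max (Δ, Δ⋆), because at most m! tuples t make i ∷ t a permutation of
-- the index sequence of a given hyperedge; so the left side of the eigenvalue equation has
-- modulus at most D M^m at the row attaining M. If ∣μ∣ exceeded D by a fixed margin,
-- the equation, valid up to an arbitrarily small error for large n, would force M → 0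
-- and hence x ≈ 0. Everything happens at a fixed n, with rational numbers and squared moduli.

module Submission where

open import Data.Nat.Base using (ℕ; _≤_; _⊔_)
open import Defs
import Algebra.Definitions.RawSemiring as RawSemiringDefinitions
open import Algebra.Properties.Monoid.Mult using (×-homo-+; ×-assocˡ)
open import Data.Bool.Base using (true; false; if_then_else_)
open import Data.Fin.Base using (Fin; zero; suc; toℕ; _↑ˡ_; _↑ʳ_; splitAt)
import Data.Fin.Properties as Fin
open import Data.Fin.Subset using (Subset) renaming (_∈_ to _∈ˢ_; ∣_∣ to card)
open import Data.Fin.Subset.Properties using () renaming (_∈?_ to _∈ˢ?_)
open import Data.Integer.Base as ℤ using (+_)
import Data.Integer.Properties as ℤ
import Data.Integer.Solver as ℤSolver
open import Data.List.Base using (List; []; _∷_; _++_; length; filter; map; allFin)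
import Data.List.Extrema
open import Data.List.Extrema.Nat using (max; xs≤max)
import Data.List.Membership.DecPropositional as DecMembership
open import Data.List.Membership.Propositional using (_∈_)
open import Data.List.Membership.Propositional.Properties
  using (∈-∃++; ∈-map⁺; ∈-map⁻; ∈-++⁻; ∈-filter⁻; ∈-allFin)
import Data.List.Relation.Unary.All as All
open import Data.List.Relation.Unary.Any using (any?; here; there)
open import Data.List.Relation.Binary.Permutation.Propositional using (↭-trans)
open import Data.List.Relation.Binary.Permutation.Propositional.Properties
  using (drop-∷; shift; ∈-resp-↭; ↭-length)
open import Data.Nat.Base as ℕ using (zero; suc; _!; z≤n; s≤s)
import Data.Nat.Properties as ℕ
open import Algebra.Properties.Semiring.Sum ℕ.+-*-semiring
  using (*-distribʳ-sum; ∑-distrib-+) renaming (sum to sumℕ)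
open import Data.Product.Base using (_,_; proj₁; proj₂; ∃-syntax; _×_)
open import Data.Rational.Base as ℚ using (ℚ; 0ℚ; 1ℚ; ½; _+_; _*_; _-_; _/_; ∣_∣)
import Data.Rational.Properties as ℚ
open import Data.Rational.Solver using (module +-*-Solver)
import Data.Rational.Unnormalised.Base as ℚᵘ
import Data.Rational.Unnormalised.Properties as ℚᵘ
open import Data.Sum.Base using (_⊎_; inj₁; inj₂)
open import Data.Vec.Base using (Vec; []; _∷_; toList; lookup)
import Data.Vec.Properties as Vec
open import Data.Vec.Functional using (Vector)
open import Function.Base using (_∘_; id)
open import Relation.Binary.Bundles using (DecTotalOrder)
open import Relation.Binary.PropositionalEquality
  using (_≡_; refl; sym; trans; cong; cong₂; subst)
open import Relation.Nullary using (¬_; Dec; yes; no; does; contradiction)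
open import Relation.Nullary.Decidable using (dec-true)
open import Relation.Unary using (Decidable)
open RawSemiringDefinitions ℚ.+-*-rawSemiring using (_^_) renaming (_×_ to _·_)
open +-*-Solver using (solve; _:=_; _:+_; _:*_; _:-_; :-_; con)

-- Counting permutations of index sequences

-- Defined through `does`, like the entries of `layeredTensor`, so that one Boolean decides both an
-- entry and its count.
⟦_⟧ : ∀ {P : Set} → Dec P → ℕ
⟦ P? ⟧ = if does P? then 1 else 0

indicator-≤1 : ∀ {P : Set} (P? : Dec P) → ⟦ P? ⟧ ≤ 1
indicator-≤1 (yes _) = s≤s z≤n
indicator-≤1 (no _)  = z≤n

indicator-mono : ∀ {P Q : Set} (P? : Dec P) (Q? : Dec Q) → (P → Q) → ⟦ P? ⟧ ≤ ⟦ Q? ⟧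
indicator-mono (no _)  _       _   = z≤n
indicator-mono (yes _) (yes _) _   = s≤s z≤n
indicator-mono (yes p) (no ¬q) p⇒q = contradiction (p⇒q p) ¬q

indicator-⊎ : ∀ {P Q R : Set} (P? : Dec P) (Q? : Dec Q) (R? : Dec R) →
              (P → Q ⊎ R) → ⟦ P? ⟧ ≤ ⟦ Q? ⟧ ℕ.+ ⟦ R? ⟧
indicator-⊎ (no _)  _       _       _ = z≤n
indicator-⊎ (yes _) (yes _) _       _ = s≤s z≤n
indicator-⊎ (yes _) (no _)  (yes _) _ = s≤s z≤n
indicator-⊎ (yes p) (no ¬q) (no ¬r) f with f p
... | inj₁ q = contradiction q ¬q
... | inj₂ r = contradiction r ¬r

sumℕ-mono : ∀ {N} {f g : Fin N → ℕ} → (∀ i → f i ≤ g i) → sumℕ f ≤ sumℕ g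
sumℕ-mono {zero}  f≤g = z≤n
sumℕ-mono {suc N} f≤g = ℕ.+-mono-≤ (f≤g zero) (sumℕ-mono (f≤g ∘ suc))

sumℕ-zero : ∀ N → sumℕ {N} (λ _ → 0) ≡ 0
sumℕ-zero zero    = refl
sumℕ-zero (suc N) = sumℕ-zero N

sumTuplesℕ : ∀ {N} m → (Vec (Fin N) m → ℕ) → ℕ
sumTuplesℕ zero    f = f []
sumTuplesℕ (suc m) f = sumℕ λ i → sumTuplesℕ m (λ t → f (i ∷ t))

sumTuplesℕ-mono : ∀ {N} m {f g : Vec (Fin N) m → ℕ} → (∀ t → f t ≤ g t) →
                  sumTuplesℕ m f ≤ sumTuplesℕ m g
sumTuplesℕ-mono zero    f≤g = f≤g []
sumTuplesℕ-mono (suc m) f≤g = sumℕ-mono λ i → sumTuplesℕ-mono m (λ t → f≤g (i ∷ t))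

sumTuplesℕ-+ : ∀ {N} m (f g : Vec (Fin N) m → ℕ) →
               sumTuplesℕ m (λ t → f t ℕ.+ g t) ≤ sumTuplesℕ m f ℕ.+ sumTuplesℕ m g
sumTuplesℕ-+ zero    f g = ℕ.≤-refl
sumTuplesℕ-+ (suc m) f g = ℕ.≤-trans
  (sumℕ-mono λ i → sumTuplesℕ-+ m (λ t → f (i ∷ t)) (λ t → g (i ∷ t)))
  (ℕ.≤-reflexive (∑-distrib-+ (λ i → sumTuplesℕ m (λ t → f (i ∷ t)))
                                (λ i → sumTuplesℕ m (λ t → g (i ∷ t)))))

sumTuplesℕ-vanish : ∀ {N} m {f : Vec (Fin N) m → ℕ} → (∀ t → f t ≤ 0) → sumTuplesℕ m f ≤ 0
sumTuplesℕ-vanish zero        f≤0 = f≤0 []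
sumTuplesℕ-vanish {N} (suc m) f≤0 = ℕ.≤-trans
  (sumℕ-mono λ i → sumTuplesℕ-vanish m (λ t → f≤0 (i ∷ t))) (ℕ.≤-reflexive (sumℕ-zero N))

module _ {N : ℕ} where
  open DecMembership (Fin._≟_ {N}) public using () renaming (_∈?_ to _∈ᴸ?_)

sum-indicator-≟ : ∀ {N} (x : Fin N) → sumℕ (λ i → ⟦ i Fin.≟ x ⟧) ≤ 1
sum-indicator-≟ {suc N} zero    = s≤s (ℕ.≤-reflexive (sumℕ-zero N))
sum-indicator-≟ {suc N} (suc x) = ℕ.≤-trans
  (sumℕ-mono λ i → indicator-mono (suc i Fin.≟ suc x) (i Fin.≟ x) Fin.suc-injective)
  (sum-indicator-≟ x)

-- Only an inequality, since a repeated element of `s` is counted once on the left.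
sum-indicator-∈ : ∀ {N} (s : List (Fin N)) → sumℕ (λ i → ⟦ i ∈ᴸ? s ⟧) ≤ length s
sum-indicator-∈ {N} []  = ℕ.≤-reflexive (sumℕ-zero N)
sum-indicator-∈ (x ∷ s) = begin
  sumℕ (λ i → ⟦ i ∈ᴸ? (x ∷ s) ⟧)
    ≤⟨ sumℕ-mono (λ i → indicator-⊎ (i ∈ᴸ? (x ∷ s)) (i Fin.≟ x) (i ∈ᴸ? s)
         λ { (here p) → inj₁ p ; (there p) → inj₂ p }) ⟩
  sumℕ (λ i → ⟦ i Fin.≟ x ⟧ ℕ.+ ⟦ i ∈ᴸ? s ⟧)
    ≡⟨ ∑-distrib-+ (λ i → ⟦ i Fin.≟ x ⟧) (λ i → ⟦ i ∈ᴸ? s ⟧) ⟩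
  sumℕ (λ i → ⟦ i Fin.≟ x ⟧) ℕ.+ sumℕ (λ i → ⟦ i ∈ᴸ? s ⟧)
    ≤⟨ ℕ.+-mono-≤ (sum-indicator-≟ x) (sum-indicator-∈ s) ⟩
  suc (length s) ∎
  where open ℕ.≤-Reasoning

-- The head of a matching tuple is an element of `s`, and `count-∷↭` bounds the number of tails for
-- each head. Repetitions in `s` can only lower the count.
count-↭ : ∀ {N} m (s : List (Fin N)) → sumTuplesℕ m (λ t → ⟦ toList t ↭? s ⟧) ≤ m !
-- Deleting one occurrence of `i` from `s` leaves the list that the tail must permute; without an
-- occurrence there is no tail.
count-∷↭ : ∀ {N} m (i : Fin N) s →
           sumTuplesℕ m (λ t → ⟦ i ∷ toList t ↭? s ⟧) ≤ ⟦ i ∈ᴸ? s ⟧ ℕ.* m !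

count-↭ zero    s = indicator-≤1 ([] ↭? s)
count-↭ (suc m) s with length s ℕ.≟ suc m
... | yes len = begin
  sumℕ (λ i → sumTuplesℕ m (λ t → ⟦ i ∷ toList t ↭? s ⟧))
    ≤⟨ sumℕ-mono (λ i → count-∷↭ m i s) ⟩
  sumℕ (λ i → ⟦ i ∈ᴸ? s ⟧ ℕ.* m !)
    ≡⟨ *-distribʳ-sum (m !) (λ i → ⟦ i ∈ᴸ? s ⟧) ⟨
  sumℕ (λ i → ⟦ i ∈ᴸ? s ⟧) ℕ.* m !
    ≤⟨ ℕ.*-monoˡ-≤ (m !) (sum-indicator-∈ s) ⟩
  length s ℕ.* m !
    ≡⟨ cong (ℕ._* m !) len ⟩
  suc m ! ∎
  where open ℕ.≤-Reasoning
-- Permutations preserve length, so no tuple matches. The case is separate because `length s` may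
-- exceed `suc m` here.
... | no len = ℕ.≤-trans
  (sumTuplesℕ-vanish (suc m) λ t → indicator-mono (toList t ↭? s) (no id)
    λ p → len (trans (sym (↭-length p)) (Vec.length-toList t)))
  z≤n

count-∷↭ m i s = bound (i ∈ᴸ? s)
  where
  -- i ∈ᴸ? s is an argument here because a with-abstraction would also hit its use inside _↭?_.
  bound : (i∈?s : Dec (i ∈ s)) → sumTuplesℕ m (λ t → ⟦ i ∷ toList t ↭? s ⟧) ≤ ⟦ i∈?s ⟧ ℕ.* m !
  bound (no i∉s) = sumTuplesℕ-vanish m λ t →
    indicator-mono (i ∷ toList t ↭? s) (no id) λ p → i∉s (∈-resp-↭ p (here refl))
  bound (yes i∈s) with ∈-∃++ i∈s
  ... | as , bs , refl = ℕ.≤-trans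
    (sumTuplesℕ-mono m λ t → indicator-mono (i ∷ toList t ↭? s) (toList t ↭? as ++ bs)
      λ p → drop-∷ (↭-trans p (shift i as bs)))
    (ℕ.≤-trans (count-↭ m (as ++ bs)) (ℕ.≤-reflexive (sym (ℕ.*-identityˡ (m !)))))

-- A union bound over the hyperedges: each contributes at most m! tuples, and none unless `i` occurs
-- in its index sequence. `Q` abstracts the incidence relation, so that original and added vertices
-- are treated alike.
count-any-∷↭ : ∀ {N} {E : Set} {Q : E → Set} (Q? : Decidable Q) (s : E → List (Fin N)) (i : Fin N) →
  (∀ e → i ∈ s e → Q e) → ∀ m es →
  sumTuplesℕ m (λ t → ⟦ any? (λ e → i ∷ toList t ↭? s e) es ⟧) ≤ length (filter Q? es) ℕ.* m !
count-any-∷↭ Q? s i ∈⇒Q m []       = sumTuplesℕ-vanish m λ _ → z≤n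
count-any-∷↭ Q? s i ∈⇒Q m (e ∷ es) = begin
  sumTuplesℕ m (λ t → ⟦ any? (λ e → i ∷ toList t ↭? s e) (e ∷ es) ⟧)
    ≤⟨ sumTuplesℕ-mono m (λ t → indicator-⊎ (any? (λ e → i ∷ toList t ↭? s e) (e ∷ es))
         (i ∷ toList t ↭? s e) (any? (λ e → i ∷ toList t ↭? s e) es)
         λ { (here p) → inj₁ p ; (there p) → inj₂ p }) ⟩
  sumTuplesℕ m (λ t → ⟦ i ∷ toList t ↭? s e ⟧ ℕ.+ ⟦ any? (λ e → i ∷ toList t ↭? s e) es ⟧)
    ≤⟨ sumTuplesℕ-+ m _ _ ⟩
  sumTuplesℕ m (λ t → ⟦ i ∷ toList t ↭? s e ⟧) ℕ.+
  sumTuplesℕ m (λ t → ⟦ any? (λ e → i ∷ toList t ↭? s e) es ⟧)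
    ≤⟨ ℕ.+-mono-≤ (count-∷↭ m i (s e)) (count-any-∷↭ Q? s i ∈⇒Q m es) ⟩
  ⟦ i ∈ᴸ? s e ⟧ ℕ.* m ! ℕ.+ length (filter Q? es) ℕ.* m !
    ≡⟨ ℕ.*-distribʳ-+ (m !) ⟦ i ∈ᴸ? s e ⟧ (length (filter Q? es)) ⟨
  (⟦ i ∈ᴸ? s e ⟧ ℕ.+ length (filter Q? es)) ℕ.* m !
    ≤⟨ ℕ.*-monoˡ-≤ (m !) step ⟩
  length (filter Q? (e ∷ es)) ℕ.* m ! ∎
  where
  open ℕ.≤-Reasoning
  step : ⟦ i ∈ᴸ? s e ⟧ ℕ.+ length (filter Q? es) ≤ length (filter Q? (e ∷ es))
  step with Q? e
  ... | yes q = ℕ.+-monoˡ-≤ (length (filter Q? es)) (indicator-≤1 (i ∈ᴸ? s e))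
  ... | no ¬q = ℕ.+-monoˡ-≤ (length (filter Q? es))
                  (indicator-mono (i ∈ᴸ? s e) (no id) (¬q ∘ ∈⇒Q e))

length-filter-map : ∀ {A B : Set} {P : B → Set} (P? : Decidable P) (f : A → B) xs →
                    length (filter P? (map f xs)) ≡ length (filter (P? ∘ f) xs)
length-filter-map P? f []       = refl
length-filter-map P? f (x ∷ xs) with does (P? (f x))
... | true  = cong suc (length-filter-map P? f xs)
... | false = length-filter-map P? f xs

≤max-map-allFin : ∀ {n} (f : Fin n → ℕ) i → f i ≤ max 0 (map f (allFin n))
≤max-map-allFin f i = All.lookup (xs≤max 0 _) (∈-map⁺ f (∈-allFin i))

↑ˡ≢↑ʳ : ∀ {n k} (v : Fin n) (l : Fin k) → ¬ v ↑ˡ k ≡ n ↑ʳ l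
↑ˡ≢↑ʳ {suc n} (suc v) l eq = ↑ˡ≢↑ʳ v l (Fin.suc-injective eq)

∈-indexSequence-↑ˡ : ∀ {n} k (e : Subset n) v → v ↑ˡ k ∈ indexSequence k e → v ∈ˢ e
∈-indexSequence-↑ˡ {n} k e v v∈ with ∈-++⁻ (map (_↑ˡ k) (filter (_∈ˢ? e) (allFin n))) v∈
... | inj₁ p with ∈-map⁻ (_↑ˡ k) p
...   | w , w∈ , eq = subst (_∈ˢ e) (sym (Fin.↑ˡ-injective k v w eq))
                        (proj₂ (∈-filter⁻ (_∈ˢ? e) {xs = allFin n} w∈))
∈-indexSequence-↑ˡ {n} k e v v∈ | inj₂ p with ∈-map⁻ (n ↑ʳ_) p
...   | l , _ , eq = contradiction eq (↑ˡ≢↑ʳ v l)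

-- The filter in `indexSequence` and the bit tabulated in `layeredEdge` test the same inequality
-- `card e ≤ suc (toℕ l)`.
∈-indexSequence-↑ʳ : ∀ {n} k (e : Subset n) l → n ↑ʳ l ∈ indexSequence k e → n ↑ʳ l ∈ˢ layeredEdge k e
∈-indexSequence-↑ʳ {n} k e l l∈ with ∈-++⁻ (map (_↑ˡ k) (filter (_∈ˢ? e) (allFin n))) l∈
... | inj₁ p with ∈-map⁻ (_↑ˡ k) p
...   | w , _ , eq = contradiction (sym eq) (↑ˡ≢↑ʳ w l)
∈-indexSequence-↑ʳ {n} k e l l∈ | inj₂ p with ∈-map⁻ (n ↑ʳ_) p
...   | l′ , l′∈ , eq with Fin.↑ʳ-injective n l l′ eq
...     | refl = Vec.lookup⇒[]= (n ↑ʳ l) (layeredEdge k e)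
  (trans (Vec.lookup-++ʳ e _ l) (trans (Vec.lookup∘tabulate _ l)
    (dec-true (card e ℕ.≤? suc (toℕ l)) (proj₂ (∈-filter⁻ _ {xs = allFin k} l′∈)))))

-- The row of an original vertex is counted by its degree in `H`, hence by `Δ H`; the row of an
-- added vertex by its degree in `layeredUniform H`, hence by `Δ⋆ H`.
rowCount-≤ : ∀ {n} (H : Hypergraph n) (i : Fin (n ℕ.+ addedVertices H)) m →
  sumTuplesℕ m (λ t → ⟦ any? (λ e → i ∷ toList t ↭? indexSequence (addedVertices H) e) (hyperedges H) ⟧)
    ≤ (Δ H ⊔ Δ⋆ H) ℕ.* m !
rowCount-≤ {n} H i m with Fin.join-splitAt n (addedVertices H) i
... | eq with splitAt n i
rowCount-≤ {n} H _ m | refl | inj₁ v = ℕ.≤-trans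
  (count-any-∷↭ (v ∈ˢ?_) (indexSequence k) (v ↑ˡ k) (λ e → ∈-indexSequence-↑ˡ k e v) m (hyperedges H))
  (ℕ.*-monoˡ-≤ (m !) (ℕ.≤-trans (≤max-map-allFin (degree H) v) (ℕ.m≤m⊔n (Δ H) (Δ⋆ H))))
  where k = addedVertices H
rowCount-≤ {n} H _ m | refl | inj₂ l = ℕ.≤-trans
  (count-any-∷↭ ((n ↑ʳ l ∈ˢ?_) ∘ layeredEdge k) (indexSequence k) (n ↑ʳ l)
    (λ e → ∈-indexSequence-↑ʳ k e l) m (hyperedges H))
  (ℕ.*-monoˡ-≤ (m !) (ℕ.≤-trans
    (ℕ.≤-reflexive (sym (length-filter-map (n ↑ʳ l ∈ˢ?_) (layeredEdge k) (hyperedges H))))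
    (ℕ.≤-trans (≤max-map-allFin (λ l → degree (layeredUniform H) (n ↑ʳ l)) l) (ℕ.m≤n⊔m (Δ H) (Δ⋆ H)))))
  where k = addedVertices H

-- Ordered-field facts about ℚ

0≤+ : ∀ {p q} → 0ℚ ℚ.≤ p → 0ℚ ℚ.≤ q → 0ℚ ℚ.≤ p + q
0≤+ = ℚ.+-mono-≤

*-mono-≤ : ∀ {p q r s} → 0ℚ ℚ.≤ q → 0ℚ ℚ.≤ r → p ℚ.≤ q → r ℚ.≤ s → p * r ℚ.≤ q * s
*-mono-≤ {p} {q} {r} {s} 0≤q 0≤r p≤q r≤s = ℚ.≤-trans
  (ℚ.*-monoʳ-≤-nonNeg r {{ℚ.nonNegative 0≤r}} p≤q)
  (ℚ.*-monoˡ-≤-nonNeg q {{ℚ.nonNegative 0≤q}} r≤s)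

0≤* : ∀ {p q} → 0ℚ ℚ.≤ p → 0ℚ ℚ.≤ q → 0ℚ ℚ.≤ p * q
0≤* {p} {q} 0≤p 0≤q = *-mono-≤ {0ℚ} {p} {0ℚ} {q} 0≤p ℚ.≤-refl 0≤p 0≤q

0<* : ∀ {p q} → 0ℚ ℚ.< p → 0ℚ ℚ.< q → 0ℚ ℚ.< p * q
0<* {p} {q} 0<p 0<q = ℚ.positive⁻¹ (p * q) {{ℚ.pos*pos⇒pos p {{ℚ.positive 0<p}} q {{ℚ.positive 0<q}}}}

p≤p+q : ∀ {p q} → 0ℚ ℚ.≤ q → p ℚ.≤ p + q
p≤p+q {p} {q} 0≤q = subst (ℚ._≤ p + q) (ℚ.+-identityʳ p) (ℚ.+-monoʳ-≤ p 0≤q)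

p<p+q : ∀ {p q} → 0ℚ ℚ.< q → p ℚ.< p + q
p<p+q {p} {q} 0<q = subst (ℚ._< p + q) (ℚ.+-identityʳ p) (ℚ.+-monoʳ-< p 0<q)

p≤∣p∣ : ∀ p → p ℚ.≤ ∣ p ∣
p≤∣p∣ p with ℚ.≤-total 0ℚ p
... | inj₁ 0≤p = ℚ.≤-reflexive (sym (ℚ.0≤p⇒∣p∣≡p 0≤p))
... | inj₂ p≤0 = ℚ.≤-trans p≤0 (ℚ.0≤∣p∣ p)

∣p∣*∣p∣ : ∀ p → ∣ p ∣ * ∣ p ∣ ≡ p * p
∣p∣*∣p∣ p with ℚ.∣p∣≡p∨∣p∣≡-p p
... | inj₁ eq = cong₂ _*_ eq eq
... | inj₂ eq = trans (cong₂ _*_ eq eq) (solve 1 (λ p → (:- p) :* (:- p) := p :* p) refl p)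

0≤p*p : ∀ p → 0ℚ ℚ.≤ p * p
0≤p*p p = subst (0ℚ ℚ.≤_) (∣p∣*∣p∣ p) (0≤* (ℚ.0≤∣p∣ p) (ℚ.0≤∣p∣ p))

square-mono-< : ∀ {p q} → 0ℚ ℚ.≤ p → p ℚ.< q → p * p ℚ.< q * q
square-mono-< {p} {q} 0≤p p<q = ℚ.≤-<-trans
  (ℚ.*-monoˡ-≤-nonNeg p {{ℚ.nonNegative 0≤p}} (ℚ.<⇒≤ p<q))
  (ℚ.*-monoˡ-<-pos q {{ℚ.positive (ℚ.≤-<-trans 0≤p p<q)}} p<q)

square-cancel-≤ : ∀ {p q} → 0ℚ ℚ.≤ q → p * p ℚ.≤ q * q → p ℚ.≤ q
square-cancel-≤ 0≤q h = ℚ.≮⇒≥ λ q<p → ℚ.<-irrefl refl (ℚ.<-≤-trans (square-mono-< 0≤q q<p) h)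

square-cancel-∣∣< : ∀ {p q} → 0ℚ ℚ.≤ q → p * p ℚ.< q * q → ∣ p ∣ ℚ.< q
square-cancel-∣∣< {p} {q} 0≤q h = ℚ.≰⇒> λ q≤∣p∣ → ℚ.<-irrefl refl (ℚ.<-≤-trans h
  (subst (q * q ℚ.≤_) (∣p∣*∣p∣ p) (*-mono-≤ (ℚ.0≤∣p∣ p) 0≤q q≤∣p∣ q≤∣p∣)))

∣p∣<q⇒p*p≤q*q : ∀ {p q} → ∣ p ∣ ℚ.< q → p * p ℚ.≤ q * q
∣p∣<q⇒p*p≤q*q {p} {q} h = subst (ℚ._≤ q * q) (∣p∣*∣p∣ p)
  (ℚ.<⇒≤ (square-mono-< (ℚ.0≤∣p∣ p) h))

^-pos : ∀ {p} → 0ℚ ℚ.< p → ∀ m → 0ℚ ℚ.< p ^ m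
^-pos 0<p zero    = ℚ.positive⁻¹ 1ℚ
^-pos 0<p (suc m) = 0<* 0<p (^-pos 0<p m)

^-nonNeg : ∀ {p} → 0ℚ ℚ.≤ p → ∀ m → 0ℚ ℚ.≤ p ^ m
^-nonNeg 0≤p zero    = ℚ.nonNegative⁻¹ 1ℚ
^-nonNeg 0≤p (suc m) = 0≤* 0≤p (^-nonNeg 0≤p m)

-- Turns ε² ≤ M into (ε^m)² ≤ M^m, the lower bound on `B` that `¬Close` requires.
^-square-≤ : ∀ {p q} → p * p ℚ.≤ q → ∀ m → p ^ m * p ^ m ℚ.≤ q ^ m
^-square-≤         h zero    = ℚ.≤-refl
^-square-≤ {p} {q} h (suc m) = subst (ℚ._≤ q * q ^ m)
  (solve 2 (λ p r → (p :* p) :* (r :* r) := (p :* r) :* (p :* r)) refl p (p ^ m))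
  (*-mono-≤ (ℚ.≤-trans (0≤p*p p) h) (0≤p*p (p ^ m)) h (^-square-≤ h m))

·-nonNeg : ∀ {c} k → 0ℚ ℚ.≤ c → 0ℚ ℚ.≤ k · c
·-nonNeg zero    0≤c = ℚ.≤-refl
·-nonNeg (suc k) 0≤c = 0≤+ 0≤c (·-nonNeg k 0≤c)

·-monoˡ-≤ : ∀ {c} → 0ℚ ℚ.≤ c → ∀ {k l} → k ≤ l → k · c ℚ.≤ l · c
·-monoˡ-≤     0≤c {l = l} ℕ.z≤n = ·-nonNeg l 0≤c
·-monoˡ-≤ {c} 0≤c (ℕ.s≤s k≤l)   = ℚ.+-monoʳ-≤ c (·-monoˡ-≤ 0≤c k≤l)

-- The triangle inequality ∣z∣ ≤ a √B, ∣w∣ ≤ b √B ⇒ ∣z + w∣ ≤ (a + b) √B, squared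
-- so that no root is taken.
triangle : ∀ {B a b} p q r s → 0ℚ ℚ.≤ B → 0ℚ ℚ.≤ a → 0ℚ ℚ.≤ b →
  p * p + q * q ℚ.≤ a * a * B → r * r + s * s ℚ.≤ b * b * B →
  (p + r) * (p + r) + (q + s) * (q + s) ℚ.≤ (a + b) * (a + b) * B
triangle {B} {a} {b} p q r s 0≤B 0≤a 0≤b hz hw = begin
  (p + r) * (p + r) + (q + s) * (q + s)
    ≡⟨ solve 4 (λ p q r s → (p :+ r) :* (p :+ r) :+ (q :+ s) :* (q :+ s) :=
         (p :* p :+ q :* q) :+ (r :* r :+ s :* s) :+ ((p :* r :+ q :* s) :+ (p :* r :+ q :* s)))
         refl p q r s ⟩
  (p * p + q * q) + (r * r + s * s) + ((p * r + q * s) + (p * r + q * s))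
    ≤⟨ ℚ.+-mono-≤ (ℚ.+-mono-≤ hz hw) (ℚ.+-mono-≤ cross cross) ⟩
  a * a * B + b * b * B + (a * b * B + a * b * B)
    ≡⟨ solve 3 (λ a b B → a :* a :* B :+ b :* b :* B :+ (a :* b :* B :+ a :* b :* B) :=
         (a :+ b) :* (a :+ b) :* B) refl a b B ⟩
  (a + b) * (a + b) * B ∎
  where
  open ℚ.≤-Reasoning
  -- The Cauchy-Schwarz inequality; the square added below completes Lagrange's identity.
  cross : p * r + q * s ℚ.≤ a * b * B
  cross = square-cancel-≤ (0≤* (0≤* 0≤a 0≤b) 0≤B) (begin
    (p * r + q * s) * (p * r + q * s)
      ≤⟨ p≤p+q (0≤p*p (p * s - q * r)) ⟩
    (p * r + q * s) * (p * r + q * s) + (p * s - q * r) * (p * s - q * r)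
      ≡⟨ solve 4 (λ p q r s → (p :* r :+ q :* s) :* (p :* r :+ q :* s) :+
           (p :* s :- q :* r) :* (p :* s :- q :* r) :=
           (p :* p :+ q :* q) :* (r :* r :+ s :* s)) refl p q r s ⟩
    (p * p + q * q) * (r * r + s * s)
      ≤⟨ *-mono-≤ (0≤* (0≤p*p a) 0≤B) (0≤+ (0≤p*p r) (0≤p*p s)) hz hw ⟩
    (a * a * B) * (b * b * B)
      ≡⟨ solve 3 (λ a b B → (a :* a :* B) :* (b :* b :* B) :=
           (a :* b :* B) :* (a :* b :* B)) refl a b B ⟩
    (a * b * B) * (a * b * B) ∎)

-- For z = p + iq and w = r + is with ∣z - w∣ ≤ √2 η ≤ γ √B, the triangle inequality
-- gives ∣w∣ ≤ (D + γ) √B.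
approximants-differ : ∀ {B D γ e} p q r s → 0ℚ ℚ.≤ D → 0ℚ ℚ.< γ → 0ℚ ℚ.< e → e * e ℚ.≤ B →
  p * p + q * q ℚ.≤ D * D * B → (D + γ + γ) * (D + γ + γ) * B ℚ.≤ r * r + s * s →
  ∣ p - r ∣ ℚ.< ½ * (γ * e) → ¬ ∣ q - s ∣ ℚ.< ½ * (γ * e)
approximants-differ {B} {D} {γ} {e} p q r s 0≤D 0<γ 0<e e²≤B hz hw close-re close-im =
  ℚ.<-irrefl refl (begin-strict
    (D + γ) * (D + γ) * B
      <⟨ ℚ.*-monoˡ-<-pos B {{ℚ.positive 0<B}} (square-mono-< (0≤+ 0≤D 0≤γ) (p<p+q 0<γ)) ⟩
    (D + γ + γ) * (D + γ + γ) * B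
      ≤⟨ hw ⟩
    r * r + s * s
      ≡⟨ cong₂ (λ a b → a * a + b * b) (p+[r-p] p r) (p+[r-p] q s) ⟨
    (p + (r - p)) * (p + (r - p)) + (q + (s - q)) * (q + (s - q))
      ≤⟨ triangle p q (r - p) (s - q) (ℚ.<⇒≤ 0<B) 0≤D 0≤γ hz error-bound ⟩
    (D + γ) * (D + γ) * B ∎)
  where
  open ℚ.≤-Reasoning
  η : ℚ
  η = ½ * (γ * e)
  0≤γ : 0ℚ ℚ.≤ γ
  0≤γ = ℚ.<⇒≤ 0<γ
  0<B : 0ℚ ℚ.< B
  0<B = ℚ.<-≤-trans (0<* 0<e 0<e) e²≤B
  p+[r-p] : ∀ p r → p + (r - p) ≡ r
  p+[r-p] = solve 2 (λ p r → p :+ (r :- p) := r) refl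
  square-flip : ∀ a b → (a - b) * (a - b) ≡ (b - a) * (b - a)
  square-flip = solve 2 (λ a b → (a :- b) :* (a :- b) := (b :- a) :* (b :- a)) refl
  error-bound : (r - p) * (r - p) + (s - q) * (s - q) ℚ.≤ γ * γ * B
  error-bound = begin
    (r - p) * (r - p) + (s - q) * (s - q)
      ≡⟨ cong₂ _+_ (square-flip r p) (square-flip s q) ⟩
    (p - r) * (p - r) + (q - s) * (q - s)
      ≤⟨ ℚ.+-mono-≤ (∣p∣<q⇒p*p≤q*q close-re) (∣p∣<q⇒p*p≤q*q close-im) ⟩
    η * η + η * η
      -- Doubling 2η² to 4η² = γ²e² is wasteful but avoids √2; the factor ½ in `η` is chosen for
      -- this.
      ≤⟨ p≤p+q (0≤+ (0≤p*p η) (0≤p*p η)) ⟩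
    η * η + η * η + (η * η + η * η)
      ≡⟨ solve 2 (λ g e → let h = con ½ :* (g :* e) in
           h :* h :+ h :* h :+ (h :* h :+ h :* h) := g :* g :* (e :* e)) refl γ e ⟩
    γ * γ * (e * e)
      ≤⟨ ℚ.*-monoˡ-≤-nonNeg (γ * γ) {{ℚ.nonNegative (0≤p*p γ)}} e²≤B ⟩
    γ * γ * B ∎

-- Complex numbers at the n-th term of their Cauchy sequences

normSq : ℕ → ℂ → ℚ
normSq n z = seq (re z) n * seq (re z) n + seq (im z) n * seq (im z) n

0≤normSq : ∀ n z → 0ℚ ℚ.≤ normSq n z
0≤normSq n z = 0≤+ (0≤p*p (seq (re z) n)) (0≤p*p (seq (im z) n))

normSq-ℚ : ∀ n q → normSq n (ℚ→ℂ q) ≡ q * q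
normSq-ℚ n q = ℚ.+-identityʳ (q * q)

normSq-* : ∀ n z w → normSq n (z *ᶜ w) ≡ normSq n z * normSq n w
normSq-* n z w = solve 4 (λ p q r s →
  (p :* r :+ :- (q :* s)) :* (p :* r :+ :- (q :* s)) :+ (p :* s :+ q :* r) :* (p :* s :+ q :* r) :=
  (p :* p :+ q :* q) :* (r :* r :+ s :* s)) refl
  (seq (re z) n) (seq (im z) n) (seq (re w) n) (seq (im w) n)

normSq-+ : ∀ n {B a b} z w → 0ℚ ℚ.≤ B → 0ℚ ℚ.≤ a → 0ℚ ℚ.≤ b →
  normSq n z ℚ.≤ a * a * B → normSq n w ℚ.≤ b * b * B →
  normSq n (z +ᶜ w) ℚ.≤ (a + b) * (a + b) * B
normSq-+ n z w = triangle (seq (re z) n) (seq (im z) n) (seq (re w) n) (seq (im w) n)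

-- The rational approximation never exceeds the true root, so a lower bound for it can be squared.
-- The truncation at 0 inside `√` has no effect on a sum of squares.
normSq-root : ∀ n z {a} → 0ℚ ℚ.≤ a → a ℚ.≤ seq ∣ z ∣ᶜ n → a * a ℚ.≤ normSq n z
normSq-root n z 0≤a h = ℚ.≤-trans (*-mono-≤ (ℚ.≤-trans 0≤a h) 0≤a h h)
  (ℚ.≤-trans (approxRoot-lower (normSq n z ℚ.⊔ 0ℚ) n (ℚ.p≤q⊔p (normSq n z) 0ℚ))
    (ℚ.≤-reflexive (ℚ.p≥q⇒p⊔q≡p (0≤normSq n z))))

normSq-re : ∀ n z {ε} → 0ℚ ℚ.< ε → normSq n z ℚ.< ε * ε → ∣ seq (re z) n ∣ ℚ.< ε
normSq-re n z 0<ε h = square-cancel-∣∣< (ℚ.<⇒≤ 0<ε)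
  (ℚ.≤-<-trans (p≤p+q (0≤p*p (seq (im z) n))) h)

normSq-im : ∀ n z {ε} → 0ℚ ℚ.< ε → normSq n z ℚ.< ε * ε → ∣ seq (im z) n ∣ ℚ.< ε
normSq-im n z {ε} 0<ε h = square-cancel-∣∣< (ℚ.<⇒≤ 0<ε)
  (ℚ.≤-<-trans (p≤p+q (0≤p*p (seq (re z) n)))
    (subst (ℚ._< ε * ε) (ℚ.+-comm (seq (re z) n * seq (re z) n) (seq (im z) n * seq (im z) n)) h))

Close : ℚ → ℂ → ℂ → ℕ → Set
Close η z w n = ∣ seq (re z) n - seq (re w) n ∣ ℚ.< η × ∣ seq (im z) n - seq (im w) n ∣ ℚ.< η

¬Close : ∀ {B D γ e} n z w → 0ℚ ℚ.≤ D → 0ℚ ℚ.< γ → 0ℚ ℚ.< e → e * e ℚ.≤ B →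
  normSq n z ℚ.≤ D * D * B → (D + γ + γ) * (D + γ + γ) * B ℚ.≤ normSq n w →
  ¬ Close (½ * (γ * e)) z w n
¬Close {B} {D} {γ} {e} n z w 0≤D 0<γ 0<e e²≤B hz hw (close-re , close-im) =
  approximants-differ {B} {D} {γ} {e} (seq (re z) n) (seq (im z) n) (seq (re w) n) (seq (im w) n)
    0≤D 0<γ 0<e e²≤B hz hw close-re close-im

normSq-^ : ∀ n z m → normSq n (z ^ᶜ m) ≡ normSq n z ^ m
normSq-^ n z zero    = refl
normSq-^ n z (suc m) = trans (normSq-* n z (z ^ᶜ m)) (cong (normSq n z *_) (normSq-^ n z m))

normSq-product : ∀ n {M} m (f : Vector ℂ m) → (∀ j → normSq n (f j) ℚ.≤ M) →
                 normSq n (product f) ℚ.≤ M ^ m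
normSq-product n     zero    f h = ℚ.≤-refl
normSq-product n {M} (suc m) f h = subst (ℚ._≤ M * M ^ m)
  (sym (normSq-* n (f zero) (product (f ∘ suc))))
  (*-mono-≤ (ℚ.≤-trans (0≤normSq n (f zero)) (h zero)) (0≤normSq n (product (f ∘ suc))) (h zero)
    (normSq-product n m (f ∘ suc) (h ∘ suc)))

module _ (n : ℕ) {B c : ℚ} (0≤B : 0ℚ ℚ.≤ B) (0≤c : 0ℚ ℚ.≤ c) where

  -- The bound ∣z∣ ≤ k c √B, squared. With `k` a natural number, a sum of terms is estimated by
  -- counting those whose tensor entry is c.
  Within : ℕ → ℂ → Set
  Within k z = normSq n z ℚ.≤ (k · c) * (k · c) * B

  within-+ : ∀ k l {z w} → Within k z → Within l w → Within (k ℕ.+ l) (z +ᶜ w)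
  within-+ k l {z} {w} hz hw = subst (λ a → normSq n (z +ᶜ w) ℚ.≤ a * a * B)
    (sym (×-homo-+ ℚ.+-0-monoid c k l))
    (normSq-+ n z w 0≤B (·-nonNeg k 0≤c) (·-nonNeg l 0≤c) hz hw)

  within-0 : Within 0 0ᶜ
  within-0 = ℚ.≤-reflexive (sym (ℚ.*-zeroˡ B))

  within-sum : ∀ {N} (w : Fin N → ℕ) {f : Vector ℂ N} → (∀ i → Within (w i) (f i)) →
               Within (sumℕ w) (sum f)
  within-sum {zero}  w     h = within-0
  within-sum {suc N} w {f} h = within-+ (w zero) (sumℕ (w ∘ suc)) {f zero} {sum (f ∘ suc)}
    (h zero) (within-sum (w ∘ suc) {f ∘ suc} (h ∘ suc))

  within-sumTuples : ∀ {N} m (w : Vec (Fin N) m → ℕ) {f : Vec (Fin N) m → ℂ} →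
                     (∀ t → Within (w t) (f t)) → Within (sumTuplesℕ m w) (sumTuples m f)
  within-sumTuples zero    w     h = h []
  within-sumTuples (suc m) w {f} h = within-sum (λ i → sumTuplesℕ m (λ t → w (i ∷ t)))
    {λ i → sumTuples m (λ t → f (i ∷ t))}
    λ i → within-sumTuples m (λ t → w (i ∷ t)) {λ t → f (i ∷ t)} (λ t → h (i ∷ t))

  within-entry : ∀ b {z} → normSq n z ℚ.≤ normSq n (if b then ℚ→ℂ c else 0ᶜ) * B →
                 Within (if b then 1 else 0) z
  within-entry true  {z} = subst (λ q → normSq n z ℚ.≤ q * B)
    (trans (normSq-ℚ n c) (cong (λ a → a * a) (sym (ℚ.+-identityʳ c))))
  within-entry false {z} = subst (λ q → normSq n z ℚ.≤ q * B) (normSq-ℚ n 0ℚ)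

-- Eventual properties of sequences

Eventually : (ℕ → Set) → Set
Eventually P = ∃[ N ] (∀ n → N ≤ n → P n)

eventually-zip : ∀ {P Q R : ℕ → Set} → (∀ n → P n → Q n → R n) →
                 Eventually P → Eventually Q → Eventually R
eventually-zip f (M , p) (N , q) = M ⊔ N , λ n h →
  f n (p n (ℕ.m⊔n≤o⇒m≤o M N h)) (q n (ℕ.m⊔n≤o⇒n≤o M N h))

eventually-map : ∀ {P Q : ℕ → Set} → (∀ n → P n → Q n) → Eventually P → Eventually Q
eventually-map f (M , p) = M , λ n h → f n (p n h)

eventually-all : ∀ {K} {P : Fin K → ℕ → Set} → (∀ i → Eventually (P i)) →
                 Eventually (λ n → ∀ i → P i n)
eventually-all {zero}  h = 0 , λ _ _ ()
eventually-all {suc K} h = eventually-zip (λ { n p q zero → p ; n p q (suc i) → q i })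
  (h zero) (eventually-all (h ∘ suc))

eventually-close : ∀ z w → z ≈ᶜ w → ∀ {η} → 0ℚ ℚ.< η → Eventually (Close η z w)
eventually-close z w (re≈ , im≈) {η} 0<η = eventually-zip (λ _ → _,_) (re≈ η 0<η) (im≈ η 0<η)

-- The given index is the starting value of the search and guarantees that `Fin K` is inhabited.
argmaximum : ∀ {K} (f : Fin K → ℚ) → Fin K → ∃[ i ] (∀ j → f j ℚ.≤ f i)
argmaximum {K} f i = argmax f i (allFin K) , λ j →
  All.lookup (f[xs]≤f[argmax] i (allFin K)) (∈-allFin j)
  where open Data.List.Extrema (DecTotalOrder.totalOrder ℚ.≤-decTotalOrder)

-- A spectral bound for hypermatrices with bounded row sums

-- The form in which absolute row sums at most D are used: terms with ∣f t∣ ≤ ∣A (i ∷ t)∣ √B have a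
-- sum of modulus at most D √B. Squaring keeps everything rational.
RowBound : ∀ {m N} → Hypermatrix (suc m) N → ℚ → Set
RowBound {m} {N} A D = ∀ n {B} → 0ℚ ℚ.≤ B → ∀ i (f : Vec (Fin N) m → ℂ) →
  (∀ t → normSq n (f t) ℚ.≤ normSq n (A (i ∷ t)) * B) →
  normSq n (sumTuples m f) ℚ.≤ D * D * B

-- The two sides of the eigenvalue equation are kept as variables: comparing
-- their instances would make Agda unfold the Cauchy proofs inside them.
module _ {m N : ℕ} (A : Hypermatrix (suc m) N) {D : ℚ} (0≤D : 0ℚ ℚ.≤ D) (row : RowBound A D)
  (μ : ℂ) (x : Vector ℂ N) (f : Fin N → Vec (Fin N) m → ℂ) (w : Fin N → ℂ)
  (normSq-f : ∀ n i t → normSq n (f i t) ≡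
    normSq n (A (i ∷ t)) * normSq n (product (λ j → x (lookup t j))))
  (normSq-w : ∀ n i → normSq n (w i) ≡ normSq n μ * normSq n (x i) ^ m)
  (eigen : ∀ i → sumTuples m (f i) ≈ᶜ w i)
  where

  eigen-close : ∀ {η} → 0ℚ ℚ.< η → Eventually (λ n → ∀ i → Close η (sumTuples m (f i)) (w i) n)
  eigen-close {η} 0<η = eventually-all {P = λ i → Close η (sumTuples m (f i)) (w i)}
    λ i → eventually-close (sumTuples m (f i)) (w i) (eigen i) 0<η

  -- For γ > 0 and ∣μ∣ ≥ D + 2γ, the equation at an entry of maximal modulus
  -- √M ≥ ε would give (D + 2γ) √B ≤ D √B + √2 η ≤ (D + γ) √B, where η = ½ γ ε^m and B = M^m.
  entries-small : ∀ {γ ε} → 0ℚ ℚ.< γ → 0ℚ ℚ.< ε → ∀ n →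
    (D + γ + γ) * (D + γ + γ) ℚ.≤ normSq n μ →
    (∀ i → Close (½ * (γ * ε ^ m)) (sumTuples m (f i)) (w i) n) →
    ∀ i → normSq n (x i) ℚ.< ε * ε
  entries-small {γ} {ε} 0<γ 0<ε n hμ close i₀ = ℚ.≤-<-trans (i-max i₀) (ℚ.≰⇒> impossible)
    where
    maximal : ∃[ i ] (∀ j → normSq n (x j) ℚ.≤ normSq n (x i))
    maximal = argmaximum (λ i → normSq n (x i)) i₀
    i : Fin N
    i = proj₁ maximal
    i-max : ∀ j → normSq n (x j) ℚ.≤ normSq n (x i)
    i-max = proj₂ maximal
    M B : ℚ
    M = normSq n (x i)
    -- Both sides of row `i` share this scale: each product on the left has squared modulus at most
    -- `B`, and the right side has exactly `normSq n μ * B`.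
    B = M ^ m
    0≤B : 0ℚ ℚ.≤ B
    0≤B = ^-nonNeg (0≤normSq n (x i)) m
    product-bound : ∀ t → normSq n (product (λ j → x (lookup t j))) ℚ.≤ B
    product-bound t = normSq-product n m (λ j → x (lookup t j)) (λ j → i-max (lookup t j))
    f-bound : normSq n (sumTuples m (f i)) ℚ.≤ D * D * B
    f-bound = row n 0≤B i (f i) λ t → subst (ℚ._≤ normSq n (A (i ∷ t)) * B) (sym (normSq-f n i t))
      (ℚ.*-monoˡ-≤-nonNeg (normSq n (A (i ∷ t))) {{ℚ.nonNegative (0≤normSq n (A (i ∷ t)))}}
        (product-bound t))
    impossible : ¬ (ε * ε ℚ.≤ M)
    impossible ε²≤M = ¬Close {B} {D} {γ} {ε ^ m} n (sumTuples m (f i)) (w i)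
      0≤D 0<γ (^-pos 0<ε m) (^-square-≤ ε²≤M m) f-bound
      (subst ((D + γ + γ) * (D + γ + γ) * B ℚ.≤_) (sym (normSq-w n i))
        (ℚ.*-monoʳ-≤-nonNeg B {{ℚ.nonNegative 0≤B}} hμ))
      (close i)

  -- The margin γ stays fixed while ε shrinks; only the tolerance ½ γ ε^m demanded of the equation
  -- depends on ε.
  entries-vanish : ∀ {γ} → 0ℚ ℚ.< γ →
    Eventually (λ n → (D + γ + γ) * (D + γ + γ) ℚ.≤ normSq n μ) → ∀ i → x i ≈ᶜ 0ᶜ
  entries-vanish {γ} 0<γ hμ i =
    (λ ε 0<ε → eventually-map (λ n small → subst (λ p → ∣ p ∣ ℚ.< ε)
      (sym (ℚ.+-identityʳ (seq (re (x i)) n))) (normSq-re n (x i) 0<ε small)) (small-entry 0<ε)) ,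
    (λ ε 0<ε → eventually-map (λ n small → subst (λ p → ∣ p ∣ ℚ.< ε)
      (sym (ℚ.+-identityʳ (seq (im (x i)) n))) (normSq-im n (x i) 0<ε small)) (small-entry 0<ε))
    where
    small-entry : ∀ {ε} → 0ℚ ℚ.< ε → Eventually (λ n → normSq n (x i) ℚ.< ε * ε)
    small-entry {ε} 0<ε = eventually-zip (λ n h close → entries-small 0<γ 0<ε n h close i)
      hμ (eigen-close (0<* (ℚ.positive⁻¹ ½) (0<* 0<γ (^-pos 0<ε m))))

-- Constructively, ≤ᴿ is the negation of eventually exceeding by a fixed margin:
-- a rational comparison at one late index decides which side holds up to ε.
≤ᴿ-stable : ∀ y D → (∀ {γ} → 0ℚ ℚ.< γ → ¬ Eventually (λ n → D + γ + γ ℚ.≤ seq y n)) → y ≤ᴿ fromℚ D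
≤ᴿ-stable y D h ε 0<ε = N , λ n N≤n → bound n N≤n
  where
  γ : ℚ
  -- A quarter of ε: three γ are spent on the term at `N`, and the fourth on passing from `N` to a
  -- later index.
  γ = ½ * (½ * ε)
  0<γ : 0ℚ ℚ.< γ
  0<γ = 0<* (ℚ.positive⁻¹ ½) (0<* (ℚ.positive⁻¹ ½) 0<ε)
  N : ℕ
  N = proj₁ (cauchy y γ 0<γ)
  near : ∀ m n → N ≤ m → N ≤ n → seq y m ℚ.≤ seq y n + γ
  near m n N≤m N≤n = subst (ℚ._≤ seq y n + γ)
    (solve 2 (λ a b → b :+ (a :- b) := a) refl (seq y m) (seq y n))
    (ℚ.+-monoʳ-≤ (seq y n) (ℚ.≤-trans (p≤∣p∣ (seq y m - seq y n)) (ℚ.<⇒≤ (proj₂ (cauchy y γ 0<γ) m n N≤m N≤n))))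
  yN≤ : seq y N ℚ.≤ D + γ + γ + γ
  -- If the term at `N` exceeded D + 3γ, every later term, being within γ of it, would be at least D
  -- + 2γ, which `h` forbids.
  yN≤ = ℚ.≮⇒≥ λ D+3γ<yN → h 0<γ (N , λ n N≤n → ℚ.≮⇒≥ λ yn< →
    ℚ.<-irrefl refl (ℚ.<-≤-trans (ℚ.<-trans (ℚ.+-monoˡ-< γ yn<) D+3γ<yN) (near N n ℕ.≤-refl N≤n)))
  bound : ∀ n → N ≤ n → seq y n ℚ.≤ D + ε
  bound n N≤n = ℚ.≤-trans (near n N N≤n ℕ.≤-refl) (subst (seq y N + γ ℚ.≤_)
    (solve 2 (λ D ε → let g = con ½ :* (con ½ :* ε) in D :+ g :+ g :+ g :+ g := D :+ ε) refl D ε)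
    (ℚ.+-monoˡ-≤ γ yN≤))

eigenvalue-bound : ∀ {m N} (A : Hypermatrix (suc m) N) {D} → 0ℚ ℚ.≤ D → RowBound A D →
                   ∀ μ → IsEigenvalue A μ → ∣ μ ∣ᶜ ≤ᴿ fromℚ D
eigenvalue-bound {m} A {D} 0≤D row μ (x , x≉0 , eigen) = ≤ᴿ-stable ∣ μ ∣ᶜ D λ {γ} 0<γ large →
  -- `≤ᴿ-stable` asks only for a contradiction, so the negative hypothesis that x is not ≈ 0
  -- suffices.
  x≉0 (entries-vanish A 0≤D row μ x _ (λ i → μ *ᶜ x i ^ᶜ m)
    (λ n i t → normSq-* n (A (i ∷ t)) (product (λ j → x (lookup t j))))
    (λ n i → trans (normSq-* n μ (x i ^ᶜ m)) (cong (normSq n μ *_) (normSq-^ n (x i) m)))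
    eigen 0<γ
    (eventually-map (λ n → normSq-root n μ (0≤+ (0≤+ 0≤D (ℚ.<⇒≤ 0<γ)) (ℚ.<⇒≤ 0<γ))) large))

-- The layered tensor

·-1/ : ∀ k d → k · (+ 1 / suc d) ≡ + k / suc d
·-1/ zero    d = sym (ℚ.0/n≡0 (suc d))
·-1/ (suc k) d = trans (cong (+ 1 / suc d ℚ.+_) (·-1/ k d))
  (ℚ.toℚᵘ-injective (begin
    ℚ.toℚᵘ (+ 1 / suc d ℚ.+ + k / suc d)            ≈⟨ ℚ.toℚᵘ-homo-+ (+ 1 / suc d) (+ k / suc d) ⟩
    ℚ.toℚᵘ (+ 1 / suc d) ℚᵘ.+ ℚ.toℚᵘ (+ k / suc d)  ≈⟨ ℚᵘ.+-cong (ℚ.toℚᵘ-fromℚᵘ (ℚᵘ.mkℚᵘ (+ 1) d)) (ℚ.toℚᵘ-fromℚᵘ (ℚᵘ.mkℚᵘ (+ k) d)) ⟩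
    ℚᵘ.mkℚᵘ (+ 1) d ℚᵘ.+ ℚᵘ.mkℚᵘ (+ k) d            ≈⟨ ℚᵘ.*≡* (identity (+ k) (+ suc d)) ⟩
    ℚᵘ.mkℚᵘ (+ suc k) d                             ≈⟨ ℚ.toℚᵘ-fromℚᵘ (ℚᵘ.mkℚᵘ (+ suc k) d) ⟨
    ℚ.toℚᵘ (+ suc k / suc d)                        ∎))
  where
  open ℚᵘ.≃-Reasoning
  identity : ∀ K L → (+ 1 ℤ.* L ℤ.+ K ℤ.* L) ℤ.* L ≡ (+ 1 ℤ.+ K) ℤ.* (L ℤ.* L)
  identity = S.solve 2 (λ K L → (S.con (+ 1) S.:* L S.:+ K S.:* L) S.:* L S.:=
    (S.con (+ 1) S.:+ K) S.:* (L S.:* L)) refl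
    where module S = ℤSolver.+-*-Solver

n·1/n≡1 : ∀ d .{{_ : ℕ.NonZero d}} → d · (+ 1 / d) ≡ 1ℚ
n·1/n≡1 (suc d) = trans (·-1/ (suc d) d) (ℚ.toℚᵘ-injective
  (ℚᵘ.≃-trans (ℚ.toℚᵘ-fromℚᵘ (ℚᵘ.mkℚᵘ (+ suc d) d))
    (ℚᵘ.*≡* (ℤ.*-comm (+ suc d) (+ 1)))))

0≤1/n : ∀ d .{{_ : ℕ.NonZero d}} → 0ℚ ℚ.≤ + 1 / d
0≤1/n d = ℚ.nonNegative⁻¹ (+ 1 / d) {{ℚ.normalize-nonNeg 1 d}}

-- Row `i` has W nonzero entries, each equal to 1/m!, and W ≤ D m! by `rowCount-≤`, so the
-- factorials cancel.
layeredTensor-rowBound : ∀ {n} (H : Hypergraph n) → RowBound (layeredTensor H) (+ (Δ H ⊔ Δ⋆ H) / 1)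
layeredTensor-rowBound H n {B} 0≤B i f f≤ = begin
  normSq n (sumTuples m f)
    ≤⟨ within-sumTuples n 0≤B 0≤c m (λ t → ⟦ edge? t ⟧)
         (λ t → within-entry n 0≤B 0≤c (does (edge? t)) {f t} (f≤ t)) ⟩
  (W · c) * (W · c) * B
    ≤⟨ ℚ.*-monoʳ-≤-nonNeg B {{ℚ.nonNegative 0≤B}}
         (*-mono-≤ (ℚ.≤-trans (·-nonNeg W 0≤c) W·c≤D) (·-nonNeg W 0≤c) W·c≤D W·c≤D) ⟩
  + D / 1 * (+ D / 1) * B ∎
  where
  open ℚ.≤-Reasoning
  m D W : ℕ
  m = addedVertices H
  D = Δ H ⊔ Δ⋆ H
  -- The decision that defines the entry of `layeredTensor H` at `i ∷ t`, so `f≤ t` has the shape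
  -- expected by `within-entry`.
  edge? = λ (t : Vec _ m) → any? (λ e → i ∷ toList t ↭? indexSequence m e) (hyperedges H)
  W = sumTuplesℕ m (λ t → ⟦ edge? t ⟧)
  instance
    m!≢0 : ℕ.NonZero (m !)
    m!≢0 = m ℕ.!≢0
  c : ℚ
  c = + 1 / m !
  0≤c : 0ℚ ℚ.≤ c
  0≤c = 0≤1/n (m !)
  W·c≤D : W · c ℚ.≤ + D / 1
  W·c≤D = begin
    W · c            ≤⟨ ·-monoˡ-≤ 0≤c (rowCount-≤ H i m) ⟩
    (D ℕ.* m !) · c  ≡⟨ ×-assocˡ ℚ.+-0-monoid c D (m !) ⟨
    D · ((m !) · c)   ≡⟨ cong (D ·_) (n·1/n≡1 (m !)) ⟩
    D · 1ℚ           ≡⟨ ·-1/ D 0 ⟩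
    + D / 1          ∎

mainTheorem2 : ∀ {n : ℕ} (H : Hypergraph n) →
    NoRepeatedHyperedge H →
    2 ≤ range H →
    ∀ (μ : ℂ) → IsEigenvalue (layeredTensor H) μ →
    ∣ μ ∣ᶜ ≤ᴿ fromℕ (Δ H ⊔ Δ⋆ H)
mainTheorem2 H _ _ = eigenvalue-bound (layeredTensor H) {+ (Δ H ⊔ Δ⋆ H) / 1}
  (ℚ.nonNegative⁻¹ (+ (Δ H ⊔ Δ⋆ H) / 1) {{ℚ.normalize-nonNeg (Δ H ⊔ Δ⋆ H) 1}}) (layeredTensor-rowBound H)
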